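{- Let $G$ be a weakly connected oriented graph on $n\ge 2$ vertices with $m\ge 1$ edges and non-zero edge weights in $\mathbb{C}\setminus\mathbb{R}^-$ such that $wt(C)\in\mathbb{R}^+$ for all even cycles $C$ of $G$. Let $u,v\in V(G)$. If $\gamma_1$ and $\gamma_2$ are both shortest walks from $u$ to $v$ in $G_u$, then $$\frac{wt(\gamma_1)}{|wt(\gamma_1)|}=\frac{wt(\gamma_2)}{|wt(\gamma_2)|}.$$
   Context: An oriented graph $G$ is obtained from a finite simple undirected graph $G_u$ (its underlying graph) by giving each edge exactly one direction; it is weakly connected if $G_u$ is connected. Each directed edge $(u,v)$ (from $u$ to $v$) has a non-zero complex weight $w_{uv}$. $\mathbb{R}^+$ and $\mathbb{R}^-$ denote the positive and the negative real numbers. Put $a_{ij}=w_{ij}$ if $(i,j)\in E(G)$, $a_{ij}=\overline{w_{ji}}$ if $(j,i)\in E(G)$, and $a_{ij}=0$ otherwise. The weight of a walk $\gamma=(i_1,\dots,i_k)$ in $G_u$ is $wt(\gamma)=\prod_{s=1}^{k-1}a_{i_si_{s+1}}$ (so a trivial one-vertex walk has weight $1$). A cycle of $G$ means a cycle of $G_u$; $wt(C)$ is the weight of the closed walk going once around $C$ in either direction (the two directions give complex conjugate values, so the condition $wt(C)\in\mathbb{R}^+$ does not depend on the choice). -}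

module Defs where

open import Data.Bool.Base using (Bool; T)
open import Data.Empty using (⊥; ⊥-elim)
open import Data.Fin.Base using (Fin)
open import Data.Integer.Base as ℤ using (+_)
import Data.Integer.Properties as ℤ
open import Data.List.Base as List using (List; []; _∷_; filter; allFin; cartesianProduct)
open import Data.List.Relation.Unary.Unique.Propositional using (Unique)
open import Data.Nat.Base as ℕ using (ℕ; zero; suc)
open import Data.Nat.Divisibility using (_∣_)
import Data.Nat.Properties as ℕ
import Data.Nat.Tactic.RingSolver as ℕ
open import Data.Product.Base using (∃; _×_; _,_; proj₁; proj₂)
open import Data.Rational.Base
open import Data.Rational.Properties
open import Data.Rational.Solver
import Data.Rational.Unnormalised.Base as ℚᵘ
import Data.Rational.Unnormalised.Properties as ℚᵘ
open import Data.Sum.Base using (_⊎_; inj₁; inj₂)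
open import Relation.Binary.Definitions using (tri<; tri≈; tri>)
open import Relation.Binary.PropositionalEquality
  using (_≡_; _≢_; refl; sym; trans; cong; cong₂; subst; subst₂)
open import Relation.Nullary using (¬_; yes; no)
open import Relation.Nullary.Decidable.Core using (T?)

open +-*-Solver using (solve; _:+_; _:*_; _:-_; :-_; _:=_; con)

0<½ε : ∀ {ε} → 0ℚ < ε → 0ℚ < ½ * ε
0<½ε {ε} p = positive⁻¹ (½ * ε) {{pos*pos⇒pos ½ ε {{positive p}}}}

0<* : ∀ {p q} → 0ℚ < p → 0ℚ < q → 0ℚ < p * q
0<* {p} {q} a b = positive⁻¹ (p * q) {{pos*pos⇒pos p {{positive a}} q {{positive b}}}}

0≤* : ∀ {p q} → 0ℚ ≤ p → 0ℚ ≤ q → 0ℚ ≤ p * q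
0≤* {p} {q} a b =
  nonNegative⁻¹ (p * q) {{nonNeg*nonNeg⇒nonNeg p {{nonNegative a}} q {{nonNegative b}}}}

0≤+ : ∀ {p q} → 0ℚ ≤ p → 0ℚ ≤ q → 0ℚ ≤ p + q
0≤+ {p} {q} a b = +-mono-≤ a b

½+½ : ∀ ε → ½ * ε + ½ * ε ≡ ε
½+½ = solve 1 (λ e → con ½ :* e :+ con ½ :* e := e) refl

*-mono-≤ : ∀ {a b c d} → 0ℚ ≤ a → 0ℚ ≤ d → a ≤ b → c ≤ d → a * c ≤ b * d
*-mono-≤ {a} {b} {c} {d} 0≤a 0≤d a≤b c≤d =
  ≤-trans (*-monoˡ-≤-nonNeg a {{nonNegative 0≤a}} c≤d)
          (*-monoʳ-≤-nonNeg d {{nonNegative 0≤d}} a≤b)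

*-mono-< : ∀ {a b c d} → 0ℚ < a → 0ℚ < d → a < b → c < d → a * c < b * d
*-mono-< {a} {b} {c} {d} 0<a 0<d a<b c<d =
  <-trans (*-monoʳ-<-pos a {{positive 0<a}} c<d)
          (*-monoˡ-<-pos d {{positive 0<d}} a<b)

0≤p² : ∀ p → 0ℚ ≤ p * p
0≤p² p with ≤-total 0ℚ p
... | inj₁ h = 0≤* h h
... | inj₂ h = subst (0ℚ ≤_)
  (solve 1 (λ x → (:- x) :* (:- x) := x :* x) refl p)
  (0≤* (neg-antimono-≤ h) (neg-antimono-≤ h))

p≤∣p∣ : ∀ p → p ≤ ∣ p ∣
p≤∣p∣ p with ≤-total 0ℚ p
... | inj₁ h = ≤-reflexive (sym (0≤p⇒∣p∣≡p h))
... | inj₂ h = ≤-trans h (0≤∣p∣ p)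

∣p-q∣-comm : ∀ p q → ∣ p - q ∣ ≡ ∣ q - p ∣
∣p-q∣-comm p q = trans (sym (∣-p∣≡∣p∣ (p - q)))
  (cong ∣_∣ (solve 2 (λ x y → :- (x :- y) := y :- x) refl p q))

∣p∣≤∣q∣+∣p-q∣ : ∀ p q → ∣ p ∣ ≤ ∣ q ∣ + ∣ p - q ∣
∣p∣≤∣q∣+∣p-q∣ p q = subst (λ r → ∣ r ∣ ≤ ∣ q ∣ + ∣ p - q ∣)
  (solve 2 (λ x y → y :+ (x :- y) := x) refl p q) (∣p+q∣≤∣p∣+∣q∣ q (p - q))

within : ∀ {p q ε} → p < q + ε → q < p + ε → ∣ p - q ∣ < ε
within {p} {q} {ε} h k with ∣p∣≡p∨∣p∣≡-p (p - q)
... | inj₁ e = subst₂ _<_ (sym e)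
  (solve 2 (λ y e → (y :+ e) :- y := e) refl q ε) (+-monoˡ-< (- q) h)
... | inj₂ e = subst₂ _<_
  (trans (solve 2 (λ x y → y :- x := :- (x :- y)) refl p q) (sym e))
  (solve 2 (λ x e → (x :+ e) :- x := e) refl p ε) (+-monoˡ-< (- p) k)

_⊔ⁿ_ : ℕ → ℕ → ℕ
_⊔ⁿ_ = ℕ._⊔_

⊔ˡ : ∀ {a b n} → a ⊔ⁿ b ℕ.≤ n → a ℕ.≤ n
⊔ˡ {a} {b} = ℕ.≤-trans (ℕ.m≤m⊔n a b)

⊔ʳ : ∀ {a b n} → a ⊔ⁿ b ℕ.≤ n → b ℕ.≤ n
⊔ʳ {a} {b} = ℕ.≤-trans (ℕ.m≤n⊔m a b)

-- Real numbers are Cauchy sequences of rationals, taken up to _≈_.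

IsCauchy : (ℕ → ℚ) → Set
IsCauchy x = ∀ ε → 0ℚ < ε → ∃ λ N → ∀ m n → N ℕ.≤ m → N ℕ.≤ n → ∣ x m - x n ∣ < ε

record ℝ : Set where
  constructor real
  field
    seq    : ℕ → ℚ
    cauchy : IsCauchy seq

open ℝ public

infix 4 _≈_ _<ℝ_ _#_

_≈_ : ℝ → ℝ → Set
x ≈ y = ∀ ε → 0ℚ < ε → ∃ λ N → ∀ n → N ℕ.≤ n → ∣ seq x n - seq y n ∣ < ε

-- The positive rational lower bound ε makes this the strict order of the
-- limits.
_<ℝ_ : ℝ → ℝ → Set
x <ℝ y = ∃ λ ε → 0ℚ < ε × ∃ λ N → ∀ n → N ℕ.≤ n → seq x n + ε < seq y n

-- Apartness, the constructive form of x ≠ y.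
_#_ : ℝ → ℝ → Set
x # y = x <ℝ y ⊎ y <ℝ x

fromℚ : ℚ → ℝ
fromℚ q = real (λ _ → q) λ ε 0<ε → 0 , λ _ _ _ _ →
  subst (λ r → ∣ r ∣ < ε) (sym (+-inverseʳ q)) 0<ε

0ℝ 1ℝ : ℝ
0ℝ = fromℚ 0ℚ
1ℝ = fromℚ 1ℚ

infixl 6 _+ℝ_ _-ℝ_
infixl 7 _*ℝ_
infix  8 -ℝ_

_+ℝ_ : ℝ → ℝ → ℝ
x +ℝ y = real (λ n → seq x n + seq y n) λ ε 0<ε →
  let M , p = cauchy x (½ * ε) (0<½ε 0<ε)
      N , q = cauchy y (½ * ε) (0<½ε 0<ε)
  in M ⊔ⁿ N , λ m n h k →
    ≤-<-trans
      (subst (λ r → ∣ r ∣ ≤ ∣ seq x m - seq x n ∣ + ∣ seq y m - seq y n ∣)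
        (solve 4 (λ a b c d → (a :- b) :+ (c :- d) := (a :+ c) :- (b :+ d)) refl
          (seq x m) (seq x n) (seq y m) (seq y n))
        (∣p+q∣≤∣p∣+∣q∣ (seq x m - seq x n) (seq y m - seq y n)))
      (subst (∣ seq x m - seq x n ∣ + ∣ seq y m - seq y n ∣ <_) (½+½ ε)
        (+-mono-< (p m n (⊔ˡ {M} {N} h) (⊔ˡ {M} {N} k)) (q m n (⊔ʳ {M} {N} h) (⊔ʳ {M} {N} k))))

-ℝ_ : ℝ → ℝ
-ℝ x = real (λ n → - seq x n) λ ε 0<ε →
  let N , p = cauchy x ε 0<ε
  in N , λ m n h k → subst (_< ε)
    (trans (∣p-q∣-comm (seq x m) (seq x n))
      (cong ∣_∣ (solve 2 (λ a b → b :- a := (:- a) :- (:- b)) refl (seq x m) (seq x n))))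
    (p m n h k)

_-ℝ_ : ℝ → ℝ → ℝ
x -ℝ y = x +ℝ (-ℝ y)

eventuallyBounded : ∀ x → ∃ λ N → ∃ λ B → 0ℚ < B × (∀ n → N ℕ.≤ n → ∣ seq x n ∣ ≤ B)
eventuallyBounded x =
  let N , p = cauchy x 1ℚ (positive⁻¹ 1ℚ)
  in N , ∣ seq x N ∣ + 1ℚ
       , +-mono-≤-< (0≤∣p∣ (seq x N)) (positive⁻¹ 1ℚ)
       , λ n h → ≤-trans (∣p∣≤∣q∣+∣p-q∣ (seq x n) (seq x N))
                   (+-monoʳ-≤ ∣ seq x N ∣ (<⇒≤ (p n N h ℕ.≤-refl)))

half-quotient : ∀ {B ε} → 0ℚ < B → 0ℚ < ε → ∃ λ δ → 0ℚ < δ × B * δ ≡ ½ * ε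
half-quotient {B} {ε} 0<B 0<ε =
  B⁻¹ * (½ * ε) , 0<* 0<B⁻¹ (0<½ε 0<ε) ,
  trans (sym (*-assoc B B⁻¹ (½ * ε)))
    (trans (cong (_* (½ * ε)) (*-inverseʳ B {{>-nonZero 0<B}})) (*-identityˡ (½ * ε)))
  where
  B⁻¹ = (1/ B) {{>-nonZero 0<B}}
  0<B⁻¹ = positive⁻¹ B⁻¹ {{1/pos⇒pos B {{positive 0<B}}}}

p≤p+q : ∀ {p q} → 0ℚ < q → p ≤ p + q
p≤p+q {p} {q} h = subst (_≤ p + q) (+-identityʳ p) (+-monoʳ-≤ p (<⇒≤ h))

p≤q+p : ∀ {p q} → 0ℚ < q → p ≤ q + p
p≤q+p {p} {q} h = subst (_≤ q + p) (+-identityˡ p) (+-monoˡ-≤ p (<⇒≤ h))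

-- B bounds both factors, and δ = ε / (2 B).
product-estimate : ∀ {a b c d B δ ε} → 0ℚ < B → B * δ ≡ ½ * ε →
  ∣ a ∣ ≤ B → ∣ d ∣ ≤ B → ∣ a - b ∣ < δ → ∣ c - d ∣ < δ → ∣ a * c - b * d ∣ < ε
product-estimate {a} {b} {c} {d} {B} {δ} {ε} 0<B eq ha hd hab hcd =
  ≤-<-trans
    (subst (λ r → ∣ r ∣ ≤ ∣ a ∣ * ∣ c - d ∣ + ∣ d ∣ * ∣ a - b ∣)
      (solve 4 (λ a b c d → a :* (c :- d) :+ d :* (a :- b) := a :* c :- b :* d) refl a b c d)
      (subst (∣ a * (c - d) + d * (a - b) ∣ ≤_)
        (cong₂ _+_ (∣p*q∣≡∣p∣*∣q∣ a (c - d)) (∣p*q∣≡∣p∣*∣q∣ d (a - b)))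
        (∣p+q∣≤∣p∣+∣q∣ (a * (c - d)) (d * (a - b)))))
    (subst (∣ a ∣ * ∣ c - d ∣ + ∣ d ∣ * ∣ a - b ∣ <_) (trans (cong₂ _+_ eq eq) (½+½ ε))
      (+-mono-< (part a (c - d) ha hcd) (part d (a - b) hd hab)))
  where
  part : ∀ p q → ∣ p ∣ ≤ B → ∣ q ∣ < δ → ∣ p ∣ * ∣ q ∣ < B * δ
  part p q hp hq = ≤-<-trans
    (*-monoʳ-≤-nonNeg ∣ q ∣ {{nonNegative (0≤∣p∣ q)}} hp)
    (*-monoʳ-<-pos B {{positive 0<B}} hq)

product-cauchy : ∀ x y → (∃ λ N → ∃ λ B → 0ℚ < B × (∀ n → N ℕ.≤ n → ∣ seq x n ∣ ≤ B)) →
  (∃ λ N → ∃ λ B → 0ℚ < B × (∀ n → N ℕ.≤ n → ∣ seq y n ∣ ≤ B)) →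
  IsCauchy (λ n → seq x n * seq y n)
product-cauchy x y (K , A , 0<A , a) (L , C , 0<C , c) ε 0<ε = (K ⊔ⁿ L) ⊔ⁿ (M ⊔ⁿ N) , bound
  where
  0<B : 0ℚ < A + C
  0<B = +-mono-< 0<A 0<C
  hq : ∃ λ δ → 0ℚ < δ × (A + C) * δ ≡ ½ * ε
  hq = half-quotient 0<B 0<ε
  δ = proj₁ hq
  0<δ = proj₁ (proj₂ hq)
  M = proj₁ (cauchy x δ 0<δ)
  N = proj₁ (cauchy y δ 0<δ)
  bound : ∀ m n → (K ⊔ⁿ L) ⊔ⁿ (M ⊔ⁿ N) ℕ.≤ m → (K ⊔ⁿ L) ⊔ⁿ (M ⊔ⁿ N) ℕ.≤ n →
          ∣ seq x m * seq y m - seq x n * seq y n ∣ < ε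
  bound m n h k =
    product-estimate {seq x m} {seq x n} {seq y m} {seq y n} {A + C} {δ} {ε} 0<B (proj₂ (proj₂ hq))
      (≤-trans (a m (⊔ˡ {K} {L} (⊔ˡ {K ⊔ⁿ L} {M ⊔ⁿ N} h))) (p≤p+q 0<C))
      (≤-trans (c n (⊔ʳ {K} {L} (⊔ˡ {K ⊔ⁿ L} {M ⊔ⁿ N} k))) (p≤q+p 0<A))
      (proj₂ (cauchy x δ 0<δ) m n (⊔ˡ {M} {N} (⊔ʳ {K ⊔ⁿ L} {M ⊔ⁿ N} h)) (⊔ˡ {M} {N} (⊔ʳ {K ⊔ⁿ L} {M ⊔ⁿ N} k)))
      (proj₂ (cauchy y δ 0<δ) m n (⊔ʳ {M} {N} (⊔ʳ {K ⊔ⁿ L} {M ⊔ⁿ N} h)) (⊔ʳ {M} {N} (⊔ʳ {K ⊔ⁿ L} {M ⊔ⁿ N} k)))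

_*ℝ_ : ℝ → ℝ → ℝ
x *ℝ y = real (λ n → seq x n * seq y n)
  (product-cauchy x y (eventuallyBounded x) (eventuallyBounded y))

-- The value at 0 is immaterial: a sequence whose limit is apart from 0 is
-- eventually non-zero.
invℚ : ℚ → ℚ
invℚ q with q ≟ 0ℚ
... | yes _  = 0ℚ
... | no q≢0 = (1/ q) {{≢-nonZero q≢0}}

invℚ-inverse : ∀ q → q ≢ 0ℚ → q * invℚ q ≡ 1ℚ
invℚ-inverse q q≢0 with q ≟ 0ℚ
... | yes e = ⊥-elim (q≢0 e)
... | no h  = *-inverseʳ q {{≢-nonZero h}}

eventuallyAway : ∀ x → x # 0ℝ →
  ∃ λ δ → 0ℚ < δ × ∃ λ N → ∀ n → N ℕ.≤ n → δ < ∣ seq x n ∣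
eventuallyAway x (inj₁ (δ , 0<δ , N , p)) = δ , 0<δ , N , λ n h →
  <-≤-trans (subst₂ _<_
    (solve 2 (λ a d → (a :+ d) :- a := d) refl (seq x n) δ)
    (+-identityˡ (- seq x n))
    (+-monoˡ-< (- seq x n) (p n h)))
  (subst (- seq x n ≤_) (∣-p∣≡∣p∣ (seq x n)) (p≤∣p∣ (- seq x n)))
eventuallyAway x (inj₂ (δ , 0<δ , N , p)) = δ , 0<δ , N , λ n h →
  <-≤-trans (subst (_< seq x n) (+-identityˡ δ) (p n h)) (p≤∣p∣ (seq x n))

δ<∣p∣⇒p≢0 : ∀ {δ p} → 0ℚ < δ → δ < ∣ p ∣ → p ≢ 0ℚ
δ<∣p∣⇒p≢0 0<δ h refl = <-irrefl refl (<-trans 0<δ h)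

inverse-estimate : ∀ {δ ε a b} → 0ℚ < δ → δ < ∣ a ∣ → δ < ∣ b ∣ →
  ∣ a - b ∣ < ε * (δ * δ) → ∣ invℚ a - invℚ b ∣ < ε
inverse-estimate {δ} {ε} {a} {b} 0<δ ha hb hab =
  *-cancelʳ-<-nonNeg (δ * δ) {{nonNegative (<⇒≤ (0<* 0<δ 0<δ))}}
    (≤-<-trans
      (*-monoˡ-≤-nonNeg ∣ a' - b' ∣ {{nonNegative (0≤∣p∣ (a' - b'))}} δδ≤)
      (subst (_< ε * (δ * δ)) eq hab))
  where
  a' = invℚ a
  b' = invℚ b
  δδ≤ : δ * δ ≤ ∣ a ∣ * ∣ b ∣
  δδ≤ = *-mono-≤ (<⇒≤ 0<δ) (0≤∣p∣ b) (<⇒≤ ha) (<⇒≤ hb)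
  ia = invℚ-inverse a (δ<∣p∣⇒p≢0 0<δ ha)
  ib = invℚ-inverse b (δ<∣p∣⇒p≢0 0<δ hb)
  eq₁ : b - a ≡ (a' - b') * (a * b)
  eq₁ = trans
    (sym (trans (cong₂ (λ s t → s * b - t * a) ia ib)
      (cong₂ _-_ (*-identityˡ b) (*-identityˡ a))))
    (solve 4 (λ a b a' b' → (a :* a') :* b :- (b :* b') :* a
                := (a' :- b') :* (a :* b)) refl a b a' b')
  eq : ∣ a - b ∣ ≡ ∣ a' - b' ∣ * (∣ a ∣ * ∣ b ∣)
  eq = trans (∣p-q∣-comm a b) (trans (cong ∣_∣ eq₁)
    (trans (∣p*q∣≡∣p∣*∣q∣ (a' - b') (a * b)) (cong (∣ a' - b' ∣ *_) (∣p*q∣≡∣p∣*∣q∣ a b))))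

inverse-cauchy : ∀ x → (∃ λ δ → 0ℚ < δ × ∃ λ N → ∀ n → N ℕ.≤ n → δ < ∣ seq x n ∣) →
  IsCauchy (λ n → invℚ (seq x n))
inverse-cauchy x (δ , 0<δ , M , away) ε 0<ε = M ⊔ⁿ N , bound
  where
  η = ε * (δ * δ)
  0<η : 0ℚ < η
  0<η = 0<* 0<ε (0<* 0<δ 0<δ)
  N = proj₁ (cauchy x η 0<η)
  bound : ∀ m n → M ⊔ⁿ N ℕ.≤ m → M ⊔ⁿ N ℕ.≤ n → ∣ invℚ (seq x m) - invℚ (seq x n) ∣ < ε
  bound m n h k =
    inverse-estimate {δ} {ε} 0<δ (away m (⊔ˡ {M} {N} h)) (away n (⊔ˡ {M} {N} k))
      (proj₂ (cauchy x η 0<η) m n (⊔ʳ {M} {N} h) (⊔ʳ {M} {N} k))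

infix 9 _⁻¹[_]

_⁻¹[_] : (x : ℝ) → x # 0ℝ → ℝ
x ⁻¹[ x#0 ] = real (λ n → invℚ (seq x n)) (inverse-cauchy x (eventuallyAway x x#0))

-- ⌊√ n⌋
isqrt : ℕ → ℕ
isqrt zero = 0
isqrt (suc n) with suc (isqrt n) ℕ.* suc (isqrt n) ℕ.≤? suc n
... | yes _ = suc (isqrt n)
... | no _  = isqrt n

isqrt-lower : ∀ n → isqrt n ℕ.* isqrt n ℕ.≤ n
isqrt-lower zero = ℕ.z≤n
isqrt-lower (suc n) with suc (isqrt n) ℕ.* suc (isqrt n) ℕ.≤? suc n
... | yes h = h
... | no _  = ℕ.m≤n⇒m≤1+n (isqrt-lower n)

isqrt-upper : ∀ n → n ℕ.< suc (isqrt n) ℕ.* suc (isqrt n)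
isqrt-upper zero = ℕ.s≤s ℕ.z≤n
isqrt-upper (suc n) with suc (isqrt n) ℕ.* suc (isqrt n) ℕ.≤? suc n
... | yes _ = ℕ.≤-<-trans (isqrt-upper n)
  (ℕ.*-mono-< (ℕ.n<1+n (suc (isqrt n))) (ℕ.n<1+n (suc (isqrt n))))
... | no h  = ℕ.≰⇒> h

-- For ∣ p ∣ = a / b and K = k + 1, this is ⌊√ (a b K²)⌋ / (b K), which
-- is at most √ ∣ p ∣ and differs from it by less than 1 / K.
√ℚ : ℕ → ℚ → ℚ
√ℚ k p@record{} =
  + isqrt (ℤ.∣ ↥ p ∣ ℕ.* ↧ₙ p ℕ.* (suc k ℕ.* suc k)) / (↧ₙ p ℕ.* suc k)

1/1+ : ℕ → ℚ
1/1+ k = + 1 / suc k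

toℚᵘ-/ : ∀ i d → toℚᵘ (i / suc d) ℚᵘ.≃ ℚᵘ.mkℚᵘ i d
toℚᵘ-/ i d = toℚᵘ-fromℚᵘ (ℚᵘ.mkℚᵘ i d)

toℚᵘ-square : ∀ s d → toℚᵘ ((+ s / suc d) * (+ s / suc d))
  ℚᵘ.≃ ℚᵘ.mkℚᵘ (+ s) d ℚᵘ.* ℚᵘ.mkℚᵘ (+ s) d
toℚᵘ-square s d = ℚᵘ.≃-trans (toℚᵘ-homo-* (+ s / suc d) (+ s / suc d))
  (ℚᵘ.*-cong (toℚᵘ-/ (+ s) d) (toℚᵘ-/ (+ s) d))

pos-*₃ : ∀ a b c → + (a ℕ.* b ℕ.* c) ≡ + a ℤ.* + b ℤ.* + c
pos-*₃ a b c = trans (ℤ.pos-* (a ℕ.* b) c) (cong (ℤ._* + c) (ℤ.pos-* a b))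

square≤ : ∀ s d p → s ℕ.* s ℕ.* ↧ₙ p ℕ.≤ ℤ.∣ ↥ p ∣ ℕ.* (suc d ℕ.* suc d) →
  (+ s / suc d) * (+ s / suc d) ≤ ∣ p ∣
square≤ s d p@record{} h = toℚᵘ-cancel-≤ (ℚᵘ.≤-respˡ-≃ (ℚᵘ.≃-sym (toℚᵘ-square s d))
  (ℚᵘ.*≤* (subst₂ ℤ._≤_ (pos-*₃ s s (↧ₙ p)) (ℤ.pos-* ℤ.∣ ↥ p ∣ (suc d ℕ.* suc d)) (ℤ.+≤+ h))))

<square : ∀ s d p → ℤ.∣ ↥ p ∣ ℕ.* (suc d ℕ.* suc d) ℕ.< s ℕ.* s ℕ.* ↧ₙ p →
  ∣ p ∣ < (+ s / suc d) * (+ s / suc d)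
<square s d p@record{} h = toℚᵘ-cancel-< (ℚᵘ.<-respʳ-≃ (ℚᵘ.≃-sym (toℚᵘ-square s d))
  (ℚᵘ.*<* (subst₂ ℤ._<_ (ℤ.pos-* ℤ.∣ ↥ p ∣ (suc d ℕ.* suc d)) (pos-*₃ s s (↧ₙ p)) (ℤ.+<+ h))))

scale : ∀ a b K → a ℕ.* b ℕ.* (K ℕ.* K) ℕ.* b ≡ a ℕ.* ((b ℕ.* K) ℕ.* (b ℕ.* K))
scale = ℕ.solve-∀

√ℚ-lower : ∀ k p → √ℚ k p * √ℚ k p ≤ ∣ p ∣
√ℚ-lower k p@record{} = square≤ (isqrt q) (k ℕ.+ ℚ.denominator-1 p ℕ.* suc k) p
  (ℕ.≤-trans (ℕ.*-monoˡ-≤ (↧ₙ p) (isqrt-lower q))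
    (ℕ.≤-reflexive (scale ℤ.∣ ↥ p ∣ (↧ₙ p) (suc k))))
  where q = ℤ.∣ ↥ p ∣ ℕ.* ↧ₙ p ℕ.* (suc k ℕ.* suc k)

0≤/ : ∀ s d → 0ℚ ≤ + s / suc d
0≤/ s d = nonNegative⁻¹ (+ s / suc d) {{normalize-nonNeg s (suc d)}}

0≤√ℚ : ∀ k p → 0ℚ ≤ √ℚ k p
0≤√ℚ k p@record{} = 0≤/ (isqrt (ℤ.∣ ↥ p ∣ ℕ.* ↧ₙ p ℕ.* (suc k ℕ.* suc k))) _

next≤ : ∀ s b k → + suc s / (suc b ℕ.* suc k) ≤ + s / (suc b ℕ.* suc k) + 1/1+ k
next≤ s b k = toℚᵘ-cancel-≤
  (ℚᵘ.≤-respˡ-≃ (ℚᵘ.≃-sym (toℚᵘ-/ (+ suc s) d))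
    (ℚᵘ.≤-respʳ-≃ (ℚᵘ.≃-sym (ℚᵘ.≃-trans (toℚᵘ-homo-+ (+ s / suc d) (1/1+ k))
        (ℚᵘ.+-cong (toℚᵘ-/ (+ s) d) (toℚᵘ-/ (+ 1) k))))
      (ℚᵘ.*≤* (subst₂ ℤ._≤_ (ℤ.pos-* (suc s) (suc d ℕ.* suc k)) eq (ℤ.+≤+ nat)))))
  where
  d = k ℕ.+ b ℕ.* suc k
  eq : + ((s ℕ.* suc k ℕ.+ 1 ℕ.* suc d) ℕ.* suc d)
     ≡ (+ s ℤ.* + suc k ℤ.+ + 1 ℤ.* + suc d) ℤ.* + suc d
  eq = trans (ℤ.pos-* (s ℕ.* suc k ℕ.+ 1 ℕ.* suc d) (suc d))
    (cong (ℤ._* + suc d) (trans (ℤ.pos-+ (s ℕ.* suc k) (1 ℕ.* suc d))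
      (cong₂ ℤ._+_ (ℤ.pos-* s (suc k)) (ℤ.pos-* 1 (suc d)))))
  rearrange : ∀ s K D → (s ℕ.* K ℕ.+ K) ℕ.* D ≡ (K ℕ.+ s ℕ.* K) ℕ.* D
  rearrange s K D = cong (ℕ._* D) (ℕ.+-comm (s ℕ.* K) K)
  nat : suc s ℕ.* (suc d ℕ.* suc k) ℕ.≤ (s ℕ.* suc k ℕ.+ 1 ℕ.* suc d) ℕ.* suc d
  nat = ℕ.≤-trans
    (ℕ.≤-reflexive (trans
      (cong (suc s ℕ.*_) (ℕ.*-comm (suc d) (suc k)))
      (trans (sym (ℕ.*-assoc (suc s) (suc k) (suc d)))
        (sym (rearrange s (suc k) (suc d))))))
    (ℕ.*-monoˡ-≤ (suc d) (ℕ.+-monoʳ-≤ (s ℕ.* suc k)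
      (ℕ.≤-trans (ℕ.m≤m+n (suc k) (b ℕ.* suc k)) (ℕ.≤-reflexive (sym (ℕ.*-identityˡ (suc d)))))))

√ℚ-upper : ∀ k p → ∣ p ∣ < (√ℚ k p + 1/1+ k) * (√ℚ k p + 1/1+ k)
√ℚ-upper k p@record{} = <-≤-trans
  (<square (suc (isqrt q)) (k ℕ.+ ℚ.denominator-1 p ℕ.* suc k) p
    (subst (ℕ._< suc (isqrt q) ℕ.* suc (isqrt q) ℕ.* ↧ₙ p)
      (scale ℤ.∣ ↥ p ∣ (↧ₙ p) (suc k))
      (ℕ.*-monoˡ-< (↧ₙ p) (isqrt-upper q))))
  (*-mono-≤ (0≤/ (suc (isqrt q)) _) (≤-trans (0≤/ (suc (isqrt q)) _) step) step step)
  where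
  q = ℤ.∣ ↥ p ∣ ℕ.* ↧ₙ p ℕ.* (suc k ℕ.* suc k)
  step = next≤ (isqrt q) (ℚ.denominator-1 p) k

archimedean : ∀ {ε} → 0ℚ < ε → ∃ λ N → ∀ k → N ℕ.≤ k → 1/1+ k ≤ ε
archimedean {mkℚ (+ suc a) b c} _ = suc b , λ k h → toℚᵘ-cancel-≤
  (ℚᵘ.≤-respˡ-≃ (ℚᵘ.≃-sym (toℚᵘ-/ (+ 1) k)) (ℚᵘ.*≤*
    (subst₂ ℤ._≤_ (ℤ.pos-* 1 (suc b)) (ℤ.pos-* (suc a) (suc k))
      (ℤ.+≤+ (ℕ.*-mono-≤ {1} {suc a} {suc b} {suc k} (ℕ.s≤s ℕ.z≤n) (ℕ.m≤n⇒m≤1+n h))))))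
archimedean {mkℚ (+ zero) b c} h = ⊥-elim (impossible (positive h))
  where
  impossible : Positive (mkℚ (+ zero) b c) → ⊥
  impossible ()
archimedean {mkℚ ℤ.-[1+ _ ] b c} h with positive h
... | ()

square-cancel-< : ∀ {a b} → 0ℚ ≤ b → a * a < b * b → a < b
square-cancel-< {a} {b} 0≤b h with <-cmp a b
... | tri< a<b _ _ = a<b
... | tri≈ _ refl _ = ⊥-elim (<-irrefl refl h)
... | tri> _ _ b<a = ⊥-elim (<-irrefl refl (<-≤-trans h
        (*-mono-≤ 0≤b (≤-trans 0≤b (<⇒≤ b<a)) (<⇒≤ b<a) (<⇒≤ b<a))))

√-gap : ∀ {a b p q k ε} → 0ℚ < ε → 0ℚ ≤ b → a * a ≤ ∣ p ∣ →
  ∣ q ∣ < (b + 1/1+ k) * (b + 1/1+ k) → 1/1+ k ≤ ½ * ε →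
  ∣ p - q ∣ < (½ * ε) * (½ * ε) → a < b + ε
√-gap {a} {b} {p} {q} {k} {ε} 0<ε 0≤b lower upper hk hpq = square-cancel-<
  (0≤+ 0≤b (<⇒≤ 0<ε))
  (≤-<-trans (≤-trans lower (∣p∣≤∣q∣+∣p-q∣ p q))
    (<-≤-trans (+-mono-< upper hpq)
      (≤-trans (+-monoˡ-≤ (h * h) (*-mono-≤ 0≤b+1/K 0≤b+h step step)) expand)))
  where
  h = ½ * ε
  0≤h = <⇒≤ (0<½ε 0<ε)
  0≤b+1/K = 0≤+ 0≤b (0≤/ 1 k)
  0≤b+h = 0≤+ 0≤b 0≤h
  step : b + 1/1+ k ≤ b + h
  step = +-monoʳ-≤ b hk
  expand : (b + h) * (b + h) + h * h ≤ (b + ε) * (b + ε)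
  expand = subst ((b + h) * (b + h) + h * h ≤_)
    (solve 2 (λ b e → let h = con ½ :* e in
      ((b :+ h) :* (b :+ h) :+ h :* h) :+ (b :* e :+ h :* e) := (b :+ e) :* (b :+ e)) refl b ε)
    (subst (_≤ (b + h) * (b + h) + h * h + (b * ε + h * ε))
      (+-identityʳ ((b + h) * (b + h) + h * h))
      (+-monoʳ-≤ ((b + h) * (b + h) + h * h) (0≤+ (0≤* 0≤b (<⇒≤ 0<ε)) (0≤* 0≤h (<⇒≤ 0<ε)))))

√-cauchy : ∀ x → IsCauchy (λ n → √ℚ n (seq x n))
√-cauchy x ε 0<ε = M ⊔ⁿ N , λ m n h k → within (gap m n h k) (gap n m k h)
  where
  δ = (½ * ε) * (½ * ε)
  0<δ : 0ℚ < δ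
  0<δ = 0<* (0<½ε 0<ε) (0<½ε 0<ε)
  M = proj₁ (archimedean (0<½ε 0<ε))
  N = proj₁ (cauchy x δ 0<δ)
  gap : ∀ m n → M ⊔ⁿ N ℕ.≤ m → M ⊔ⁿ N ℕ.≤ n → √ℚ m (seq x m) < √ℚ n (seq x n) + ε
  gap m n h k = √-gap {p = seq x m} {seq x n} {n} 0<ε (0≤√ℚ n (seq x n))
    (√ℚ-lower m (seq x m)) (√ℚ-upper n (seq x n))
    (proj₂ (archimedean (0<½ε 0<ε)) n (⊔ˡ {M} {N} k))
    (proj₂ (cauchy x δ 0<δ) m n (⊔ʳ {M} {N} h) (⊔ʳ {M} {N} k))

-- The square root of the absolute value, hence √ x whenever x is
-- non-negative; it is only applied to sums of squares below.
√∣_∣ : ℝ → ℝ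
√∣ x ∣ = real (λ n → √ℚ n (seq x n)) (√-cauchy x)

square-pos : ∀ x → x # 0ℝ → 0ℝ <ℝ x *ℝ x
square-pos x x#0 =
  let δ , 0<δ , N , away = eventuallyAway x x#0
  in δ * δ , 0<* 0<δ 0<δ , N , λ n h →
    subst₂ _<_ (sym (+-identityˡ (δ * δ)))
      (trans (sym (∣p*q∣≡∣p∣*∣q∣ (seq x n) (seq x n))) (0≤p⇒∣p∣≡p (0≤p² (seq x n))))
      (*-mono-< 0<δ (<-trans 0<δ (away n h)) (away n h) (away n h))

small-square : ∀ {ε} → 0ℚ < ε → ∃ λ h → 0ℚ < h × h * h ≤ ε
small-square {ε} 0<ε with ≤-total ε 1ℚ
... | inj₁ ε≤1 = ε , 0<ε , subst (ε * ε ≤_) (*-identityʳ ε)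
  (*-monoˡ-≤-nonNeg ε {{nonNegative (<⇒≤ 0<ε)}} ε≤1)
... | inj₂ 1≤ε = 1ℚ , positive⁻¹ 1ℚ , 1≤ε

√-pos : ∀ x → 0ℝ <ℝ x → 0ℝ <ℝ √∣ x ∣
√-pos x (ε , 0<ε , M , lower) = η , 0<½ε 0<h , M ⊔ⁿ N , bound
  where
  h = proj₁ (small-square 0<ε)
  0<h = proj₁ (proj₂ (small-square 0<ε))
  hh≤ε = proj₂ (proj₂ (small-square 0<ε))
  η = ½ * h
  N = proj₁ (archimedean (0<½ε 0<h))
  bound : ∀ n → M ⊔ⁿ N ℕ.≤ n → 0ℚ + η < √ℚ n (seq x n)
  bound n k = subst (_< √ℚ n (seq x n)) (sym (+-identityˡ η)) (≰⇒> λ r≤η →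
    let r+1/K≤h = subst (√ℚ n (seq x n) + 1/1+ n ≤_) (½+½ h)
          (+-mono-≤ r≤η (proj₂ (archimedean (0<½ε 0<h)) n (⊔ʳ {M} {N} k)))
        0≤r+1/K = 0≤+ (0≤√ℚ n (seq x n)) (0≤/ 1 n)
    in <-irrefl refl (<-≤-trans
      (<-trans (subst (_< seq x n) (+-identityˡ ε) (lower n (⊔ˡ {M} {N} k)))
        (≤-<-trans (p≤∣p∣ (seq x n)) (√ℚ-upper n (seq x n))))
      (≤-trans (*-mono-≤ 0≤r+1/K (<⇒≤ 0<h) r+1/K≤h r+1/K≤h) hh≤ε)))

infix 5 _+i_

record ℂ : Set where
  constructor _+i_
  field
    re im : ℝ

open ℂ public

infix 4 _≈ℂ_

_≈ℂ_ : ℂ → ℂ → Set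
z ≈ℂ w = re z ≈ re w × im z ≈ im w

0ℂ 1ℂ : ℂ
0ℂ = 0ℝ +i 0ℝ
1ℂ = 1ℝ +i 0ℝ

infixl 7 _*ℂ_

_*ℂ_ : ℂ → ℂ → ℂ
z *ℂ w = re z *ℝ re w -ℝ im z *ℝ im w +i re z *ℝ im w +ℝ im z *ℝ re w

conj : ℂ → ℂ
conj z = re z +i -ℝ im z

normSq : ℂ → ℝ
normSq z = re z *ℝ re z +ℝ im z *ℝ im z

∣_∣ℂ : ℂ → ℝ
∣ z ∣ℂ = √∣ normSq z ∣

infix 7 _/_[_]

_/_[_] : ℂ → (r : ℝ) → r # 0ℝ → ℂ
z / r [ r#0 ] = re z *ℝ r ⁻¹[ r#0 ] +i im z *ℝ r ⁻¹[ r#0 ]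

-- Apartness from 0, which equals z ≠ 0 classically and is what makes
-- division by the modulus possible constructively.
NonZeroℂ : ℂ → Set
NonZeroℂ z = re z # 0ℝ ⊎ im z # 0ℝ

PositiveReal NegativeReal : ℂ → Set
PositiveReal z = 0ℝ <ℝ re z × im z ≈ 0ℝ
NegativeReal z = re z <ℝ 0ℝ × im z ≈ 0ℝ

normSq-pos : ∀ z → NonZeroℂ z → 0ℝ <ℝ normSq z
normSq-pos z (inj₁ re#0) =
  let ε , 0<ε , N , p = square-pos (re z) re#0
  in ε , 0<ε , N , λ n h → subst (_< seq (normSq z) n) (+-identityʳ (0ℚ + ε))
       (+-mono-<-≤ (p n h) (0≤p² (seq (im z) n)))
normSq-pos z (inj₂ im#0) =
  let ε , 0<ε , N , p = square-pos (im z) im#0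
  in ε , 0<ε , N , λ n h → subst (_< seq (normSq z) n) (+-identityˡ (0ℚ + ε))
       (+-mono-≤-< (0≤p² (seq (re z) n)) (p n h))

normSq-conj : ∀ z → 0ℝ <ℝ normSq z → 0ℝ <ℝ normSq (conj z)
normSq-conj z (ε , 0<ε , N , p) = ε , 0<ε , N , λ n h → subst (0ℚ + ε <_)
  (solve 2 (λ a b → a :* a :+ b :* b := a :* a :+ (:- b) :* (:- b)) refl
    (seq (re z) n) (seq (im z) n))
  (p n h)

normSq-* : ∀ z w → 0ℝ <ℝ normSq z → 0ℝ <ℝ normSq w → 0ℝ <ℝ normSq (z *ℂ w)
normSq-* z w (ε , 0<ε , M , p) (δ , 0<δ , N , q) =
  ε * δ , 0<* 0<ε 0<δ , M ⊔ⁿ N , λ n h → subst₂ _<_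
    (sym (+-identityˡ (ε * δ)))
    (solve 4 (λ a b c d → (a :* a :+ b :* b) :* (c :* c :+ d :* d)
        := (a :* c :+ (:- (b :* d))) :* (a :* c :+ (:- (b :* d)))
             :+ (a :* d :+ b :* c) :* (a :* d :+ b :* c)) refl
      (seq (re z) n) (seq (im z) n) (seq (re w) n) (seq (im w) n))
    (let p' = subst (_< seq (normSq z) n) (+-identityˡ ε) (p n (⊔ˡ {M} {N} h))
         q' = subst (_< seq (normSq w) n) (+-identityˡ δ) (q n (⊔ʳ {M} {N} h))
     in *-mono-< 0<ε (<-trans 0<δ q') p' q')

normSq-1 : 0ℝ <ℝ normSq 1ℂ
normSq-1 = ½ , positive⁻¹ ½ , 0 , λ _ _ → ½<1
  where
  ½<1 : 0ℚ + ½ < 1ℚ * 1ℚ + 0ℚ * 0ℚ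
  ½<1 = *<* (ℤ.+<+ (ℕ.s≤s (ℕ.s≤s ℕ.z≤n)))

-- Asymmetry rules out loops and says that each edge of the underlying
-- simple graph carries exactly one direction.
record OrientedGraph (n : ℕ) : Set where
  field
    edge : Fin n → Fin n → Bool

  Edge : Fin n → Fin n → Set
  Edge i j = T (edge i j)

  field
    asym : ∀ {i j} → Edge i j → ¬ Edge j i

  -- Adjacency in the underlying simple graph, in which walks and cycles live.
  _~_ : Fin n → Fin n → Set
  i ~ j = Edge i j ⊎ Edge j i

  edgeCount : ℕ
  edgeCount = List.length
    (filter (λ (i , j) → T? (edge i j)) (cartesianProduct (allFin n) (allFin n)))

  infixr 5 _∷_

  data Walk : Fin n → Fin n → Set where
    []  : ∀ {i} → Walk i i
    _∷_ : ∀ {i j k} → i ~ j → Walk j k → Walk i k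

  length : ∀ {i j} → Walk i j → ℕ
  length []      = 0
  length (_ ∷ γ) = suc (length γ)

  -- All vertices in order of traversal, except the final one.
  sources : ∀ {i j} → Walk i j → List (Fin n)
  sources []            = []
  sources (_∷_ {i} _ γ) = i ∷ sources γ

  WeaklyConnected : Set
  WeaklyConnected = ∀ i j → Walk i j

  -- A cycle is presented by a choice of starting vertex and direction; its
  -- weight being a positive real does not depend on that choice.
  IsCycle : ∀ {i} → Walk i i → Set
  IsCycle C = 3 ℕ.≤ length C × Unique (sources C)

  IsEven : ∀ {i j} → Walk i j → Set
  IsEven γ = 2 ∣ length γ

  IsShortest : ∀ {i j} → Walk i j → Set
  IsShortest {i} {j} γ = ∀ (γ′ : Walk i j) → length γ ℕ.≤ length γ′

record Weighting {n : ℕ} (G : OrientedGraph n) : Set where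
  open OrientedGraph G
  field
    w   : ∀ i j → Edge i j → ℂ
    w≠0 : ∀ i j (e : Edge i j) → NonZeroℂ (w i j e)

  a : Fin n → Fin n → ℂ
  a i j with T? (edge i j) | T? (edge j i)
  ... | yes e | _     = w i j e
  ... | no _  | yes e = conj (w j i e)
  ... | no _  | no _  = 0ℂ

  wt : ∀ {i j} → Walk i j → ℂ
  wt []                = 1ℂ
  wt (_∷_ {i} {j} _ γ) = a i j *ℂ wt γ

  normSq-a : ∀ {i j} → i ~ j → 0ℝ <ℝ normSq (a i j)
  normSq-a {i} {j} i~j with T? (edge i j) | T? (edge j i) | i~j
  ... | yes e | _     | _      = normSq-pos (w i j e) (w≠0 i j e)
  ... | no _  | yes e | _      = normSq-conj (w j i e) (normSq-pos (w j i e) (w≠0 j i e))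
  ... | no ¬e | no _  | inj₁ e = ⊥-elim (¬e e)
  ... | no _  | no ¬e | inj₂ e = ⊥-elim (¬e e)

  normSq-wt : ∀ {i j} (γ : Walk i j) → 0ℝ <ℝ normSq (wt γ)
  normSq-wt []                = normSq-1
  normSq-wt (_∷_ {i} {j} e γ) = normSq-* (a i j) (wt γ) (normSq-a e) (normSq-wt γ)

  ∣wt∣#0 : ∀ {i j} (γ : Walk i j) → ∣ wt γ ∣ℂ # 0ℝ
  ∣wt∣#0 γ = inj₂ (√-pos (normSq (wt γ)) (normSq-wt γ))

{-# OPTIONS --safe #-}

-- Say that z and w have the same direction when z · conj w is a positive real.
-- This is reflexive on non-zero numbers, compatible with products, and implies
-- z / ∣z∣ = w / ∣w∣.  By induction on the length, any two shortest walks from u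
-- to v have weights of the same direction: if they share an interior vertex,
-- both split there into shorter shortest walks; if they do not, following γ₁
-- and then γ₂ backwards is an even cycle, of weight wt γ₁ · conj (wt γ₂).

module Submission where

open import Defs
open import Data.Empty using (⊥-elim)
open import Data.Fin.Base using (Fin)
open import Data.Fin.Properties using () renaming (_≟_ to _≟ᶠ_)
open import Data.List.Base as List using ([]; _∷_)
open import Data.List.Membership.Propositional using (_∈_; _∉_; find)
open import Data.List.Relation.Binary.Disjoint.Propositional using (Disjoint)
open import Data.List.Relation.Binary.Permutation.Propositional
  using (_↭_; ↭-refl; ↭-sym; ↭-trans; prep; ↭⇒↭ₛ)
open import Data.List.Relation.Binary.Permutation.Propositional.Properties
  using (++⁺ʳ; ∷↭∷ʳ; ∈-resp-↭)
import Data.List.Relation.Binary.Permutation.Setoid.Properties as Permutation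
open import Data.List.Relation.Unary.All.Properties using (¬Any⇒All¬)
open import Data.List.Relation.Unary.AllPairs using ([]; _∷_)
open import Data.List.Relation.Unary.Any as Any using (any?; here; there)
open import Data.List.Relation.Unary.Unique.Propositional using (Unique)
open import Data.List.Relation.Unary.Unique.Propositional.Properties using (++⁺)
open import Data.Nat.Base using (ℕ; suc; _≤_; _<_; s≤s; z≤n; _+_; _*_)
open import Data.Nat.Divisibility using (divides)
open import Data.Nat.Induction using (<-rec)
import Data.Nat.Properties as ℕ
open import Data.Product.Base using (∃; _×_; _,_; proj₁; proj₂)
open import Data.Rational.Base as ℚ using (0ℚ; 1ℚ; ½; ∣_∣)
import Data.Rational.Properties as ℚ
open import Data.Rational.Solver
open import Data.Sum.Base using (inj₂; swap)
open import Relation.Binary.Bundles using (Setoid)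
open import Relation.Binary.PropositionalEquality
  using (_≡_; refl; sym; trans; cong; cong₂; subst; subst₂)
import Relation.Binary.PropositionalEquality.Properties as ≡
import Relation.Binary.Reasoning.Setoid as SetoidReasoning
open import Relation.Nullary using (¬_; yes; no)
open import Relation.Nullary.Decidable.Core using (T?)

open +-*-Solver using (solve; _:+_; _:*_; _:-_; :-_; _:=_; con)

-- Real numbers

eventually≡⇒≈ : ∀ x y → (∃ λ N → ∀ n → N ≤ n → seq x n ≡ seq y n) → x ≈ y
eventually≡⇒≈ x y (N , h) ε 0<ε = N , λ n N≤n →
  subst (λ r → ∣ r ∣ ℚ.< ε)
    (sym (trans (cong (ℚ._- seq y n) (h n N≤n)) (ℚ.+-inverseʳ (seq y n)))) 0<ε

pointwise⇒≈ : ∀ x y → (∀ n → seq x n ≡ seq y n) → x ≈ y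
pointwise⇒≈ x y h = eventually≡⇒≈ x y (0 , λ n _ → h n)

≈-refl : ∀ x → x ≈ x
≈-refl x = pointwise⇒≈ x x λ _ → refl

≈-sym : ∀ x y → x ≈ y → y ≈ x
≈-sym x y h ε 0<ε =
  let N , p = h ε 0<ε
  in N , λ n N≤n → subst (ℚ._< ε) (∣p-q∣-comm (seq x n) (seq y n)) (p n N≤n)

≈-trans : ∀ x y z → x ≈ y → y ≈ z → x ≈ z
≈-trans x y z h k ε 0<ε =
  let M , p = h (½ ℚ.* ε) (0<½ε 0<ε)
      N , q = k (½ ℚ.* ε) (0<½ε 0<ε)
  in M ⊔ⁿ N , λ n l → ℚ.≤-<-trans
    (subst (λ r → ∣ r ∣ ℚ.≤ ∣ seq x n ℚ.- seq y n ∣ ℚ.+ ∣ seq y n ℚ.- seq z n ∣)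
      (solve 3 (λ a b c → (a :- b) :+ (b :- c) := a :- c) refl (seq x n) (seq y n) (seq z n))
      (ℚ.∣p+q∣≤∣p∣+∣q∣ (seq x n ℚ.- seq y n) (seq y n ℚ.- seq z n)))
    (subst (∣ seq x n ℚ.- seq y n ∣ ℚ.+ ∣ seq y n ℚ.- seq z n ∣ ℚ.<_) (½+½ ε)
      (ℚ.+-mono-< (p n (⊔ˡ {M} {N} l)) (q n (⊔ʳ {M} {N} l))))

ℝ-setoid : Setoid _ _
ℝ-setoid = record
  { Carrier = ℝ
  ; _≈_ = _≈_
  ; isEquivalence = record
    { refl  = λ {x} → ≈-refl x
    ; sym   = λ {x} {y} → ≈-sym x y
    ; trans = λ {x} {y} {z} → ≈-trans x y z
    }
  }

open SetoidReasoning ℝ-setoid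

+-cong : ∀ x y u v → x ≈ y → u ≈ v → x +ℝ u ≈ y +ℝ v
+-cong x y u v h k ε 0<ε =
  let M , p = h (½ ℚ.* ε) (0<½ε 0<ε)
      N , q = k (½ ℚ.* ε) (0<½ε 0<ε)
  in M ⊔ⁿ N , λ n l → ℚ.≤-<-trans
    (subst (λ r → ∣ r ∣ ℚ.≤ ∣ seq x n ℚ.- seq y n ∣ ℚ.+ ∣ seq u n ℚ.- seq v n ∣)
      (solve 4 (λ a b c d → (a :- b) :+ (c :- d) := (a :+ c) :- (b :+ d)) refl
        (seq x n) (seq y n) (seq u n) (seq v n))
      (ℚ.∣p+q∣≤∣p∣+∣q∣ (seq x n ℚ.- seq y n) (seq u n ℚ.- seq v n)))
    (subst (∣ seq x n ℚ.- seq y n ∣ ℚ.+ ∣ seq u n ℚ.- seq v n ∣ ℚ.<_) (½+½ ε)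
      (ℚ.+-mono-< (p n (⊔ˡ {M} {N} l)) (q n (⊔ʳ {M} {N} l))))

*-cong : ∀ x y u v → x ≈ y → u ≈ v → x *ℝ u ≈ y *ℝ v
*-cong x y u v h k ε 0<ε =
  let K , A , 0<A , a     = eventuallyBounded x
      L , C , 0<C , c     = eventuallyBounded v
      δ , 0<δ , [A+C]δ≡ε/2 = half-quotient (ℚ.+-mono-< 0<A 0<C) 0<ε
      M , p               = h δ 0<δ
      N , q               = k δ 0<δ
  in (K ⊔ⁿ L) ⊔ⁿ (M ⊔ⁿ N) , λ n l →
    product-estimate {seq x n} {seq y n} {seq u n} {seq v n} (ℚ.+-mono-< 0<A 0<C) [A+C]δ≡ε/2
      (ℚ.≤-trans (a n (⊔ˡ {K} {L} (⊔ˡ {K ⊔ⁿ L} {M ⊔ⁿ N} l))) (p≤p+q 0<C))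
      (ℚ.≤-trans (c n (⊔ʳ {K} {L} (⊔ˡ {K ⊔ⁿ L} {M ⊔ⁿ N} l))) (p≤q+p 0<A))
      (p n (⊔ˡ {M} {N} (⊔ʳ {K ⊔ⁿ L} {M ⊔ⁿ N} l)))
      (q n (⊔ʳ {M} {N} (⊔ʳ {K ⊔ⁿ L} {M ⊔ⁿ N} l)))

*-congˡ : ∀ x u v → u ≈ v → x *ℝ u ≈ x *ℝ v
*-congˡ x u v = *-cong x x u v (≈-refl x)

*-congʳ : ∀ x y u → x ≈ y → x *ℝ u ≈ y *ℝ u
*-congʳ x y u h = *-cong x y u u h (≈-refl u)

*-zeroʳ : ∀ x z → z ≈ 0ℝ → x *ℝ z ≈ 0ℝ
*-zeroʳ x z h = begin
  x *ℝ z   ≈⟨ *-congˡ x z 0ℝ h ⟩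
  x *ℝ 0ℝ  ≈⟨ pointwise⇒≈ (x *ℝ 0ℝ) 0ℝ (λ n → ℚ.*-zeroʳ (seq x n)) ⟩
  0ℝ       ∎

x+z≈x : ∀ x z → z ≈ 0ℝ → x +ℝ z ≈ x
x+z≈x x z h = begin
  x +ℝ z   ≈⟨ +-cong x x z 0ℝ (≈-refl x) h ⟩
  x +ℝ 0ℝ  ≈⟨ pointwise⇒≈ (x +ℝ 0ℝ) x (λ n → ℚ.+-identityʳ (seq x n)) ⟩
  x        ∎

-‿zero : ∀ z → z ≈ 0ℝ → -ℝ z ≈ 0ℝ
-‿zero z h = begin
  -ℝ z            ≈⟨ pointwise⇒≈ (-ℝ z) (fromℚ (ℚ.- 1ℚ) *ℝ z)
                       (λ n → solve 1 (λ a → :- a := con (ℚ.- 1ℚ) :* a) refl (seq z n)) ⟩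
  fromℚ (ℚ.- 1ℚ) *ℝ z  ≈⟨ *-zeroʳ (fromℚ (ℚ.- 1ℚ)) z h ⟩
  0ℝ              ∎

0<-resp-≈ : ∀ x y → x ≈ y → 0ℝ <ℝ x → 0ℝ <ℝ y
0<-resp-≈ x y h (ε , 0<ε , M , p) =
  let N , q = h (½ ℚ.* ε) (0<½ε 0<ε)
  in ½ ℚ.* ε , 0<½ε 0<ε , M ⊔ⁿ N , λ n l →
    subst₂ ℚ._<_
      (solve 1 (λ e → e :- con ½ :* e := con 0ℚ :+ con ½ :* e) refl ε)
      (solve 2 (λ a b → a :- (a :- b) := b) refl (seq x n) (seq y n))
      (ℚ.+-mono-<
        (subst (ℚ._< seq x n) (ℚ.+-identityˡ ε) (p n (⊔ˡ {M} {N} l)))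
        (ℚ.neg-antimono-< (ℚ.≤-<-trans (p≤∣p∣ (seq x n ℚ.- seq y n)) (q n (⊔ʳ {M} {N} l)))))

0<-+ : ∀ x y → 0ℝ <ℝ x → 0ℝ <ℝ y → 0ℝ <ℝ x +ℝ y
0<-+ x y (ε , 0<ε , M , p) (δ , 0<δ , N , q) =
  ε ℚ.+ δ , ℚ.+-mono-< 0<ε 0<δ , M ⊔ⁿ N , λ n l →
    subst (ℚ._< seq x n ℚ.+ seq y n)
      (solve 2 (λ e d → (con 0ℚ :+ e) :+ (con 0ℚ :+ d) := con 0ℚ :+ (e :+ d)) refl ε δ)
      (ℚ.+-mono-< (p n (⊔ˡ {M} {N} l)) (q n (⊔ʳ {M} {N} l)))

0<-* : ∀ x y → 0ℝ <ℝ x → 0ℝ <ℝ y → 0ℝ <ℝ x *ℝ y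
0<-* x y (ε , 0<ε , M , p) (δ , 0<δ , N , q) =
  ε ℚ.* δ , 0<* 0<ε 0<δ , M ⊔ⁿ N , λ n l →
    let ε<x = subst (ℚ._< seq x n) (ℚ.+-identityˡ ε) (p n (⊔ˡ {M} {N} l))
        δ<y = subst (ℚ._< seq y n) (ℚ.+-identityˡ δ) (q n (⊔ʳ {M} {N} l))
    in subst (ℚ._< seq x n ℚ.* seq y n) (sym (ℚ.+-identityˡ (ε ℚ.* δ)))
         (*-mono-< 0<ε (ℚ.<-trans 0<δ δ<y) ε<x δ<y)

*-inverseʳ : ∀ x (x#0 : x # 0ℝ) → x *ℝ x ⁻¹[ x#0 ] ≈ 1ℝ
*-inverseʳ x x#0 = eventually≡⇒≈ (x *ℝ x ⁻¹[ x#0 ]) 1ℝ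
  (let δ , 0<δ , N , away = eventuallyAway x x#0
   in N , λ n l → invℚ-inverse (seq x n) (δ<∣p∣⇒p≢0 0<δ (away n l)))

cross-multiply : ∀ x y a b (a#0 : a # 0ℝ) (b#0 : b # 0ℝ) → x *ℝ b ≈ a *ℝ y →
  x *ℝ a ⁻¹[ a#0 ] ≈ y *ℝ b ⁻¹[ b#0 ]
cross-multiply x y a b a#0 b#0 h = begin
  x *ℝ a⁻¹                    ≈⟨ pointwise⇒≈ (x *ℝ a⁻¹) ((x *ℝ a⁻¹) *ℝ 1ℝ)
                                   (λ n → sym (ℚ.*-identityʳ (seq (x *ℝ a⁻¹) n))) ⟩
  (x *ℝ a⁻¹) *ℝ 1ℝ            ≈⟨ *-congˡ (x *ℝ a⁻¹) (b *ℝ b⁻¹) 1ℝ (*-inverseʳ b b#0) ⟨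
  (x *ℝ a⁻¹) *ℝ (b *ℝ b⁻¹)    ≈⟨ pointwise⇒≈ ((x *ℝ a⁻¹) *ℝ (b *ℝ b⁻¹)) ((x *ℝ b) *ℝ (a⁻¹ *ℝ b⁻¹))
                                   (λ n → solve 4 (λ x b s t → (x :* s) :* (b :* t) := (x :* b) :* (s :* t)) refl
                                     (seq x n) (seq b n) (seq a⁻¹ n) (seq b⁻¹ n)) ⟩
  (x *ℝ b) *ℝ (a⁻¹ *ℝ b⁻¹)    ≈⟨ *-congʳ (x *ℝ b) (a *ℝ y) (a⁻¹ *ℝ b⁻¹) h ⟩
  (a *ℝ y) *ℝ (a⁻¹ *ℝ b⁻¹)    ≈⟨ pointwise⇒≈ ((a *ℝ y) *ℝ (a⁻¹ *ℝ b⁻¹)) ((y *ℝ b⁻¹) *ℝ (a *ℝ a⁻¹))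
                                   (λ n → solve 4 (λ y a s t → (a :* y) :* (s :* t) := (y :* t) :* (a :* s)) refl
                                     (seq y n) (seq a n) (seq a⁻¹ n) (seq b⁻¹ n)) ⟩
  (y *ℝ b⁻¹) *ℝ (a *ℝ a⁻¹)    ≈⟨ *-congˡ (y *ℝ b⁻¹) (a *ℝ a⁻¹) 1ℝ (*-inverseʳ a a#0) ⟩
  (y *ℝ b⁻¹) *ℝ 1ℝ            ≈⟨ pointwise⇒≈ ((y *ℝ b⁻¹) *ℝ 1ℝ) (y *ℝ b⁻¹)
                                   (λ n → ℚ.*-identityʳ (seq (y *ℝ b⁻¹) n)) ⟩
  y *ℝ b⁻¹                    ∎
  where
  a⁻¹ = a ⁻¹[ a#0 ]
  b⁻¹ = b ⁻¹[ b#0 ]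

*-cancelʳ : ∀ x y c → c # 0ℝ → x *ℝ c ≈ y *ℝ c → x ≈ y
*-cancelʳ x y c c#0 h = begin
  x                  ≈⟨ unit x ⟨
  (x *ℝ c) *ℝ c⁻¹    ≈⟨ *-congʳ (x *ℝ c) (y *ℝ c) c⁻¹ h ⟩
  (y *ℝ c) *ℝ c⁻¹    ≈⟨ unit y ⟩
  y                  ∎
  where
  c⁻¹ = c ⁻¹[ c#0 ]
  unit : ∀ z → (z *ℝ c) *ℝ c⁻¹ ≈ z
  unit z = begin
    (z *ℝ c) *ℝ c⁻¹  ≈⟨ pointwise⇒≈ ((z *ℝ c) *ℝ c⁻¹) (z *ℝ (c *ℝ c⁻¹))
                          (λ n → ℚ.*-assoc (seq z n) (seq c n) (seq c⁻¹ n)) ⟩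
    z *ℝ (c *ℝ c⁻¹)  ≈⟨ *-congˡ z (c *ℝ c⁻¹) 1ℝ (*-inverseʳ c c#0) ⟩
    z *ℝ 1ℝ          ≈⟨ pointwise⇒≈ (z *ℝ 1ℝ) z (λ n → ℚ.*-identityʳ (seq z n)) ⟩
    z                ∎

square-injective : ∀ s t → 0ℝ <ℝ s → 0ℝ <ℝ t → s *ℝ s ≈ t *ℝ t → s ≈ t
square-injective s t 0<s 0<t h = *-cancelʳ s t (s +ℝ t) (inj₂ (0<-+ s t 0<s 0<t)) (begin
  s *ℝ (s +ℝ t)       ≈⟨ pointwise⇒≈ (s *ℝ (s +ℝ t)) (s *ℝ s +ℝ s *ℝ t)
                           (λ n → ℚ.*-distribˡ-+ (seq s n) (seq s n) (seq t n)) ⟩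
  s *ℝ s +ℝ s *ℝ t    ≈⟨ +-cong (s *ℝ s) (t *ℝ t) (s *ℝ t) (s *ℝ t) h (≈-refl (s *ℝ t)) ⟩
  t *ℝ t +ℝ s *ℝ t    ≈⟨ pointwise⇒≈ (t *ℝ t +ℝ s *ℝ t) (t *ℝ (s +ℝ t))
                           (λ n → solve 2 (λ s t → t :* t :+ s :* t := t :* (s :+ t)) refl
                             (seq s n) (seq t n)) ⟩
  t *ℝ (s +ℝ t)       ∎)

√-square : ∀ x → 0ℝ <ℝ x → √∣ x ∣ *ℝ √∣ x ∣ ≈ x
√-square x (η , 0<η , L , p) ε 0<ε = (K ⊔ⁿ L) ⊔ⁿ (M ⊔ⁿ N) , estimate
  where
  bounded = eventuallyBounded √∣ x ∣
  K = proj₁ bounded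
  B = proj₁ (proj₂ bounded)
  0<B = proj₁ (proj₂ (proj₂ bounded))
  r≤B = proj₂ (proj₂ (proj₂ bounded))
  0<B+1 = ℚ.+-mono-< 0<B (ℚ.positive⁻¹ 1ℚ)
  quotient = half-quotient 0<B+1 0<ε
  δ = proj₁ quotient
  0<δ = proj₁ (proj₂ quotient)
  M = proj₁ (archimedean (0<½ε 0<δ))
  N = proj₁ (archimedean (ℚ.positive⁻¹ 1ℚ))

  estimate : ∀ n → (K ⊔ⁿ L) ⊔ⁿ (M ⊔ⁿ N) ≤ n → ∣ seq (√∣ x ∣ *ℝ √∣ x ∣) n ℚ.- seq x n ∣ ℚ.< ε
  estimate n l = ℚ.≤-<-trans
    (subst (ℚ._≤ s ℚ.* s ℚ.- r ℚ.* r) (sym ∣rr-q∣≡q-rr)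
      (ℚ.+-monoˡ-≤ (ℚ.- (r ℚ.* r)) (ℚ.≤-trans (p≤∣p∣ q) (ℚ.<⇒≤ (√ℚ-upper n q)))))
    (ℚ.≤-<-trans (p≤∣p∣ (s ℚ.* s ℚ.- r ℚ.* r))
      (product-estimate {s} {r} {s} {r} 0<B+1 (proj₂ (proj₂ quotient))
        ∣s∣≤B+1 ∣r∣≤B+1 ∣s-r∣<δ ∣s-r∣<δ))
    where
    q = seq x n
    r = √ℚ n q
    s = r ℚ.+ 1/1+ n
    0≤q : 0ℚ ℚ.≤ q
    0≤q = ℚ.<⇒≤ (ℚ.<-trans 0<η
      (subst (ℚ._< q) (ℚ.+-identityˡ η) (p n (⊔ʳ {K} {L} (⊔ˡ {K ⊔ⁿ L} {M ⊔ⁿ N} l)))))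
    rr≤q : r ℚ.* r ℚ.≤ q
    rr≤q = subst (r ℚ.* r ℚ.≤_) (ℚ.0≤p⇒∣p∣≡p 0≤q) (√ℚ-lower n q)
    ∣rr-q∣≡q-rr : ∣ r ℚ.* r ℚ.- q ∣ ≡ q ℚ.- r ℚ.* r
    ∣rr-q∣≡q-rr = trans (∣p-q∣-comm (r ℚ.* r) q) (ℚ.0≤p⇒∣p∣≡p
      (subst (ℚ._≤ q ℚ.- r ℚ.* r) (ℚ.+-inverseʳ (r ℚ.* r)) (ℚ.+-monoˡ-≤ (ℚ.- (r ℚ.* r)) rr≤q)))
    ∣r∣≤B = r≤B n (⊔ˡ {K} {L} (⊔ˡ {K ⊔ⁿ L} {M ⊔ⁿ N} l))
    ∣r∣≤B+1 = ℚ.≤-trans ∣r∣≤B (p≤p+q (ℚ.positive⁻¹ 1ℚ))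
    0≤s = 0≤+ (0≤√ℚ n q) (0≤/ 1 n)
    ∣s∣≤B+1 : ∣ s ∣ ℚ.≤ B ℚ.+ 1ℚ
    ∣s∣≤B+1 = subst (ℚ._≤ B ℚ.+ 1ℚ) (sym (ℚ.0≤p⇒∣p∣≡p 0≤s))
      (ℚ.+-mono-≤ (ℚ.≤-trans (p≤∣p∣ r) ∣r∣≤B)
        (proj₂ (archimedean (ℚ.positive⁻¹ 1ℚ)) n (⊔ʳ {M} {N} (⊔ʳ {K ⊔ⁿ L} {M ⊔ⁿ N} l))))
    ∣s-r∣<δ : ∣ s ℚ.- r ∣ ℚ.< δ
    ∣s-r∣<δ = subst (ℚ._< δ)
      (sym (trans (cong ∣_∣ (solve 2 (λ r k → (r :+ k) :- r := k) refl r (1/1+ n)))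
        (ℚ.0≤p⇒∣p∣≡p (0≤/ 1 n))))
      (ℚ.≤-<-trans (proj₂ (archimedean (0<½ε 0<δ)) n (⊔ˡ {M} {N} (⊔ʳ {K ⊔ⁿ L} {M ⊔ⁿ N} l)))
        (subst₂ ℚ._<_ (ℚ.+-identityʳ (½ ℚ.* δ)) (½+½ δ)
          (ℚ.+-monoʳ-< (½ ℚ.* δ) (0<½ε 0<δ))))

-- Complex numbers

infix 4 _≗ℂ_

-- The algebraic identities between weights hold term by term along the
-- representing sequences, so no limits are needed for them.
_≗ℂ_ : ℂ → ℂ → Set
z ≗ℂ w = (∀ n → seq (re z) n ≡ seq (re w) n) × (∀ n → seq (im z) n ≡ seq (im w) n)

≗ℂ-refl : ∀ z → z ≗ℂ z
≗ℂ-refl z = (λ _ → refl) , λ _ → refl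

≗ℂ-sym : ∀ z w → z ≗ℂ w → w ≗ℂ z
≗ℂ-sym z w (h , k) = (λ n → sym (h n)) , λ n → sym (k n)

≗ℂ-trans : ∀ z w t → z ≗ℂ w → w ≗ℂ t → z ≗ℂ t
≗ℂ-trans z w t (h , k) (h′ , k′) = (λ n → trans (h n) (h′ n)) , λ n → trans (k n) (k′ n)

*ℂ-cong : ∀ z w s t → z ≗ℂ w → s ≗ℂ t → z *ℂ s ≗ℂ w *ℂ t
*ℂ-cong z w s t (h , k) (h′ , k′) =
  (λ n → cong₂ ℚ._-_ (cong₂ ℚ._*_ (h n) (h′ n)) (cong₂ ℚ._*_ (k n) (k′ n))) ,
  λ n → cong₂ ℚ._+_ (cong₂ ℚ._*_ (h n) (k′ n)) (cong₂ ℚ._*_ (k n) (h′ n))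

*ℂ-assoc : ∀ z w t → (z *ℂ w) *ℂ t ≗ℂ z *ℂ (w *ℂ t)
*ℂ-assoc z w t =
  (λ n → solve 6 (λ a b c d e f →
      (a :* c :- b :* d) :* e :- (a :* d :+ b :* c) :* f
        := a :* (c :* e :- d :* f) :- b :* (c :* f :+ d :* e)) refl
    (seq (re z) n) (seq (im z) n) (seq (re w) n) (seq (im w) n) (seq (re t) n) (seq (im t) n)) ,
  λ n → solve 6 (λ a b c d e f →
      (a :* c :- b :* d) :* f :+ (a :* d :+ b :* c) :* e
        := a :* (c :* f :+ d :* e) :+ b :* (c :* e :- d :* f)) refl
    (seq (re z) n) (seq (im z) n) (seq (re w) n) (seq (im w) n) (seq (re t) n) (seq (im t) n)

*ℂ-comm : ∀ z w → z *ℂ w ≗ℂ w *ℂ z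
*ℂ-comm z w =
  (λ n → solve 4 (λ a b c d → a :* c :- b :* d := c :* a :- d :* b) refl
    (seq (re z) n) (seq (im z) n) (seq (re w) n) (seq (im w) n)) ,
  λ n → solve 4 (λ a b c d → a :* d :+ b :* c := c :* b :+ d :* a) refl
    (seq (re z) n) (seq (im z) n) (seq (re w) n) (seq (im w) n)

*ℂ-identityˡ : ∀ z → 1ℂ *ℂ z ≗ℂ z
*ℂ-identityˡ z =
  (λ n → solve 2 (λ a b → con 1ℚ :* a :- con 0ℚ :* b := a) refl (seq (re z) n) (seq (im z) n)) ,
  λ n → solve 2 (λ a b → con 1ℚ :* b :+ con 0ℚ :* a := b) refl (seq (re z) n) (seq (im z) n)

conj-*ℂ : ∀ z w → conj (z *ℂ w) ≗ℂ conj z *ℂ conj w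
conj-*ℂ z w =
  (λ n → solve 4 (λ a b c d → a :* c :- b :* d := a :* c :- (:- b) :* (:- d)) refl
    (seq (re z) n) (seq (im z) n) (seq (re w) n) (seq (im w) n)) ,
  λ n → solve 4 (λ a b c d → :- (a :* d :+ b :* c) := a :* (:- d) :+ (:- b) :* c) refl
    (seq (re z) n) (seq (im z) n) (seq (re w) n) (seq (im w) n)

conj-involutive : ∀ z → z ≗ℂ conj (conj z)
conj-involutive z = (λ _ → refl) , λ n → solve 1 (λ b → b := :- (:- b)) refl (seq (im z) n)

PositiveReal-resp-≗ℂ : ∀ z w → z ≗ℂ w → PositiveReal z → PositiveReal w
PositiveReal-resp-≗ℂ z w (h , k) (0<re , im≈0) =
  0<-resp-≈ (re z) (re w) (pointwise⇒≈ (re z) (re w) h) 0<re ,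
  ≈-trans (im w) (im z) 0ℝ (pointwise⇒≈ (im w) (im z) λ n → sym (k n)) im≈0

PositiveReal-* : ∀ z w → PositiveReal z → PositiveReal w → PositiveReal (z *ℂ w)
PositiveReal-* z w (0<rz , iz≈0) (0<rw , iw≈0) =
  0<-resp-≈ (re z *ℝ re w) (re (z *ℂ w))
    (≈-sym (re (z *ℂ w)) (re z *ℝ re w)
      (x+z≈x (re z *ℝ re w) (-ℝ (im z *ℝ im w))
        (-‿zero (im z *ℝ im w) (*-zeroʳ (im z) (im w) iw≈0))))
    (0<-* (re z) (re w) 0<rz 0<rw) ,
  (begin
    re z *ℝ im w +ℝ im z *ℝ re w  ≈⟨ pointwise⇒≈ (im (z *ℂ w)) (re z *ℝ im w +ℝ re w *ℝ im z)
                                      (λ n → cong (seq (re z *ℝ im w) n ℚ.+_)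
                                        (ℚ.*-comm (seq (im z) n) (seq (re w) n))) ⟩
    re z *ℝ im w +ℝ re w *ℝ im z  ≈⟨ x+z≈x (re z *ℝ im w) (re w *ℝ im z) (*-zeroʳ (re w) (im z) iz≈0) ⟩
    re z *ℝ im w                  ≈⟨ *-zeroʳ (re z) (im w) iw≈0 ⟩
    0ℝ                            ∎)

SameDirection : ℂ → ℂ → Set
SameDirection z w = PositiveReal (z *ℂ conj w)

SameDirection-refl : ∀ z → 0ℝ <ℝ normSq z → SameDirection z z
SameDirection-refl z 0<∣z∣² =
  0<-resp-≈ (normSq z) (re (z *ℂ conj z))
    (pointwise⇒≈ (normSq z) (re (z *ℂ conj z)) (λ n →
      solve 2 (λ a b → a :* a :+ b :* b := a :* a :- b :* (:- b)) refl (seq (re z) n) (seq (im z) n)))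
    0<∣z∣² ,
  pointwise⇒≈ (im (z *ℂ conj z)) 0ℝ (λ n →
    solve 2 (λ a b → a :* (:- b) :+ b :* a := con 0ℚ) refl (seq (re z) n) (seq (im z) n))

SameDirection-resp-≗ℂ : ∀ z z′ w w′ → z ≗ℂ z′ → w ≗ℂ w′ → SameDirection z w → SameDirection z′ w′
SameDirection-resp-≗ℂ z z′ w w′ h (k , k′) =
  PositiveReal-resp-≗ℂ (z *ℂ conj w) (z′ *ℂ conj w′)
    (*ℂ-cong z z′ (conj w) (conj w′) h (k , λ n → cong ℚ.-_ (k′ n)))

SameDirection-* : ∀ z w s t → SameDirection z w → SameDirection s t → SameDirection (z *ℂ s) (w *ℂ t)
SameDirection-* z w s t h k =
  PositiveReal-resp-≗ℂ ((z *ℂ conj w) *ℂ (s *ℂ conj t)) ((z *ℂ s) *ℂ conj (w *ℂ t))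
    ( (λ n → solve 8 (λ a b c d e f g h →
          (a :* c :- b :* (:- d)) :* (e :* g :- f :* (:- h))
            :- (a :* (:- d) :+ b :* c) :* (e :* (:- h) :+ f :* g)
          := (a :* e :- b :* f) :* (c :* g :- d :* h)
            :- (a :* f :+ b :* e) :* (:- (c :* h :+ d :* g))) refl
        (seq (re z) n) (seq (im z) n) (seq (re w) n) (seq (im w) n)
        (seq (re s) n) (seq (im s) n) (seq (re t) n) (seq (im t) n))
    , λ n → solve 8 (λ a b c d e f g h →
          (a :* c :- b :* (:- d)) :* (e :* (:- h) :+ f :* g)
            :+ (a :* (:- d) :+ b :* c) :* (e :* g :- f :* (:- h))
          := (a :* e :- b :* f) :* (:- (c :* h :+ d :* g))
            :+ (a :* f :+ b :* e) :* (c :* g :- d :* h)) refl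
        (seq (re z) n) (seq (im z) n) (seq (re w) n) (seq (im w) n)
        (seq (re s) n) (seq (im s) n) (seq (re t) n) (seq (im t) n) )
    (PositiveReal-* (z *ℂ conj w) (s *ℂ conj t) h k)

-- With p + i q = z · conj w and q = 0, we have ∣z∣² ∣w∣² = p² + q² = p², hence
-- p = ∣z∣ ∣w∣, and the coordinates of z ∣w∣² = (p + i q) w can be divided by
-- ∣z∣ ∣w∣².
SameDirection⇒≈ : ∀ z w → 0ℝ <ℝ normSq z → 0ℝ <ℝ normSq w →
  (z#0 : ∣ z ∣ℂ # 0ℝ) (w#0 : ∣ w ∣ℂ # 0ℝ) → SameDirection z w →
  z / ∣ z ∣ℂ [ z#0 ] ≈ℂ w / ∣ w ∣ℂ [ w#0 ]
SameDirection⇒≈ z w 0<∣z∣² 0<∣w∣² z#0 w#0 (0<p , q≈0) =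
  coordinate (re z) (re w) (-ℝ (im w *ℝ q))
    (-‿zero (im w *ℝ q) (*-zeroʳ (im w) q q≈0))
    (λ n → solve 4 (λ a b c d →
        a :* (c :* c :+ d :* d)
          := (a :* c :- b :* (:- d)) :* c :+ (:- (d :* (a :* (:- d) :+ b :* c)))) refl
      (seq (re z) n) (seq (im z) n) (seq (re w) n) (seq (im w) n)) ,
  coordinate (im z) (im w) (re w *ℝ q)
    (*-zeroʳ (re w) q q≈0)
    (λ n → solve 4 (λ a b c d →
        b :* (c :* c :+ d :* d)
          := (a :* c :- b :* (:- d)) :* d :+ c :* (a :* (:- d) :+ b :* c)) refl
      (seq (re z) n) (seq (im z) n) (seq (re w) n) (seq (im w) n))
  where
  p = re (z *ℂ conj w)
  q = im (z *ℂ conj w)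
  A = ∣ z ∣ℂ
  B = ∣ w ∣ℂ
  0<A = √-pos (normSq z) 0<∣z∣²
  0<B = √-pos (normSq w) 0<∣w∣²

  AB≈p : A *ℝ B ≈ p
  AB≈p = square-injective (A *ℝ B) p (0<-* A B 0<A 0<B) 0<p (begin
    (A *ℝ B) *ℝ (A *ℝ B)   ≈⟨ pointwise⇒≈ ((A *ℝ B) *ℝ (A *ℝ B)) ((A *ℝ A) *ℝ (B *ℝ B))
                                (λ n → solve 2 (λ a b → (a :* b) :* (a :* b) := (a :* a) :* (b :* b)) refl
                                  (seq A n) (seq B n)) ⟩
    (A *ℝ A) *ℝ (B *ℝ B)   ≈⟨ *-cong (A *ℝ A) (normSq z) (B *ℝ B) (normSq w)
                                (√-square (normSq z) 0<∣z∣²) (√-square (normSq w) 0<∣w∣²) ⟩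
    normSq z *ℝ normSq w   ≈⟨ pointwise⇒≈ (normSq z *ℝ normSq w) (p *ℝ p +ℝ q *ℝ q)
                                (λ n → solve 4 (λ a b c d →
                                  (a :* a :+ b :* b) :* (c :* c :+ d :* d)
                                    := (a :* c :- b :* (:- d)) :* (a :* c :- b :* (:- d))
                                      :+ (a :* (:- d) :+ b :* c) :* (a :* (:- d) :+ b :* c)) refl
                                  (seq (re z) n) (seq (im z) n) (seq (re w) n) (seq (im w) n)) ⟩
    p *ℝ p +ℝ q *ℝ q       ≈⟨ x+z≈x (p *ℝ p) (q *ℝ q) (*-zeroʳ q q q≈0) ⟩
    p *ℝ p                 ∎)

  coordinate : ∀ x y e → e ≈ 0ℝ → (∀ n → seq (x *ℝ normSq w) n ≡ seq (p *ℝ y +ℝ e) n) →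
    x *ℝ A ⁻¹[ z#0 ] ≈ y *ℝ B ⁻¹[ w#0 ]
  coordinate x y e e≈0 h = cross-multiply x y A B z#0 w#0
    (*-cancelʳ (x *ℝ B) (A *ℝ y) B w#0 (begin
      (x *ℝ B) *ℝ B    ≈⟨ pointwise⇒≈ ((x *ℝ B) *ℝ B) (x *ℝ (B *ℝ B))
                            (λ n → ℚ.*-assoc (seq x n) (seq B n) (seq B n)) ⟩
      x *ℝ (B *ℝ B)    ≈⟨ *-congˡ x (B *ℝ B) (normSq w) (√-square (normSq w) 0<∣w∣²) ⟩
      x *ℝ normSq w    ≈⟨ pointwise⇒≈ (x *ℝ normSq w) (p *ℝ y +ℝ e) h ⟩
      p *ℝ y +ℝ e      ≈⟨ x+z≈x (p *ℝ y) e e≈0 ⟩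
      p *ℝ y           ≈⟨ *-congʳ (A *ℝ B) p y AB≈p ⟨
      (A *ℝ B) *ℝ y    ≈⟨ pointwise⇒≈ ((A *ℝ B) *ℝ y) ((A *ℝ y) *ℝ B)
                            (λ n → solve 3 (λ a b y → (a :* b) :* y := (a :* y) :* b) refl
                              (seq A n) (seq B n) (seq y n)) ⟩
      (A *ℝ y) *ℝ B    ∎))

-- Walks

module _ {n : ℕ} (G : OrientedGraph n) where
  open OrientedGraph G

  infixr 5 _++_

  _++_ : ∀ {i j k} → Walk i j → Walk j k → Walk i k
  []      ++ β = β
  (e ∷ α) ++ β = e ∷ (α ++ β)

  reverse : ∀ {i j} → Walk i j → Walk j i
  reverse []      = []
  reverse (e ∷ γ) = reverse γ ++ (swap e ∷ [])

  length-++ : ∀ {i j k} (α : Walk i j) (β : Walk j k) → length (α ++ β) ≡ length α + length β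
  length-++ []      β = refl
  length-++ (e ∷ α) β = cong suc (length-++ α β)

  length-reverse : ∀ {i j} (γ : Walk i j) → length (reverse γ) ≡ length γ
  length-reverse []      = refl
  length-reverse (e ∷ γ) = trans (length-++ (reverse γ) (swap e ∷ []))
    (trans (ℕ.+-comm (length (reverse γ)) 1) (cong suc (length-reverse γ)))

  sources-++ : ∀ {i j k} (α : Walk i j) (β : Walk j k) → sources (α ++ β) ≡ sources α List.++ sources β
  sources-++ []              β = refl
  sources-++ (_∷_ {i} e α) β = cong (i ∷_) (sources-++ α β)

  sources-reverse : ∀ {i j k} (e : i ~ j) (γ : Walk j k) → sources (reverse (e ∷ γ)) ↭ k ∷ sources γ
  sources-reverse e []                = ↭-refl
  sources-reverse {j = j} {k} e (f ∷ γ) = subst (_↭ k ∷ j ∷ sources γ)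
    (sym (sources-++ (reverse (f ∷ γ)) (swap e ∷ [])))
    (↭-trans (++⁺ʳ (j ∷ []) (sources-reverse f γ)) (prep k (↭-sym (∷↭∷ʳ j (sources γ)))))

  split : ∀ {i j x} (γ : Walk i j) → x ∈ sources γ →
    ∃ λ (α : Walk i x) → ∃ λ (β : Walk x j) → γ ≡ α ++ β × 1 ≤ length β
  split (e ∷ γ) (here refl) = [] , e ∷ γ , refl , s≤s z≤n
  split (e ∷ γ) (there x∈γ) =
    let α , β , γ≡α++β , 1≤β = split γ x∈γ
    in e ∷ α , β , cong (e ∷_) γ≡α++β , 1≤β

  shortest-prefix : ∀ {i j k} (α : Walk i j) (β : Walk j k) → IsShortest (α ++ β) → IsShortest α
  shortest-prefix α β short α′ = ℕ.+-cancelʳ-≤ (length β) (length α) (length α′)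
    (subst₂ _≤_ (length-++ α β) (length-++ α′ β) (short (α′ ++ β)))

  shortest-suffix : ∀ {i j k} (α : Walk i j) (β : Walk j k) → IsShortest (α ++ β) → IsShortest β
  shortest-suffix α β short β′ = ℕ.+-cancelˡ-≤ (length α) (length β) (length β′)
    (subst₂ _≤_ (length-++ α β) (length-++ α β′) (short (α ++ β′)))

  shortest⇒start∉ : ∀ {i j k} (e : i ~ j) (γ : Walk j k) → IsShortest (e ∷ γ) → i ∉ sources γ
  shortest⇒start∉ e γ short i∈γ with split γ i∈γ
  ... | α , β , refl , _ = ℕ.<⇒≱ (s≤s (ℕ.m≤n+m (length β) (length α)))
    (subst (λ l → suc l ≤ length β) (length-++ α β) (short β))

  shortest⇒end∉ : ∀ {i j} (γ : Walk i j) → IsShortest γ → j ∉ sources γ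
  shortest⇒end∉ γ short j∈γ with split γ j∈γ
  ... | α , β , refl , 1≤β = ℕ.<⇒≱ (ℕ.m<m+n (length α) 1≤β)
    (subst (_≤ length α) (length-++ α β) (short α))

  shortest⇒unique : ∀ {i j} (γ : Walk i j) → IsShortest γ → Unique (sources γ)
  shortest⇒unique []      short = []
  shortest⇒unique (e ∷ γ) short = ¬Any⇒All¬ (sources γ) (shortest⇒start∉ e γ short)
    ∷ shortest⇒unique γ (shortest-suffix (e ∷ []) γ short)

  shortest-lengths : ∀ {i j} (γ₁ γ₂ : Walk i j) → IsShortest γ₁ → IsShortest γ₂ → length γ₁ ≡ length γ₂
  shortest-lengths γ₁ γ₂ short₁ short₂ = ℕ.≤-antisym (short₁ γ₂) (short₂ γ₁)

  disjoint⇒cycle-unique : ∀ {u j k v} (e : u ~ j) (f : u ~ k) (α : Walk j v) (β : Walk k v) →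
    IsShortest (e ∷ α) → IsShortest (f ∷ β) → Disjoint (sources α) (sources β) →
    Unique (sources ((e ∷ α) ++ reverse (f ∷ β)))
  disjoint⇒cycle-unique {u} {v = v} e f α β shortα shortβ α#β =
    subst Unique (sym (sources-++ (e ∷ α) (reverse (f ∷ β))))
      (++⁺ (shortest⇒unique (e ∷ α) shortα)
        (Permutation.Unique-resp-↭ (≡.setoid (Fin n)) (↭⇒↭ₛ (↭-sym β↭))
          (¬Any⇒All¬ (sources β) (λ v∈β → shortest⇒end∉ (f ∷ β) shortβ (there v∈β))
            ∷ shortest⇒unique β (shortest-suffix (f ∷ []) β shortβ)))
        (λ (x∈α , x∈β) → disjoint (x∈α , ∈-resp-↭ β↭ x∈β)))
    where
    β↭ = sources-reverse f β
    disjoint : Disjoint (u ∷ sources α) (v ∷ sources β)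
    disjoint (x∈α       , here refl)  = shortest⇒end∉ (e ∷ α) shortα x∈α
    disjoint (here refl , there u∈β) = shortest⇒start∉ f β shortβ u∈β
    disjoint (there x∈α , there x∈β) = α#β (x∈α , x∈β)

  module _ (W : Weighting G) where
    open Weighting W

    wt-++ : ∀ {i j k} (α : Walk i j) (β : Walk j k) → wt (α ++ β) ≗ℂ wt α *ℂ wt β
    wt-++ [] β = ≗ℂ-sym (1ℂ *ℂ wt β) (wt β) (*ℂ-identityˡ (wt β))
    wt-++ (_∷_ {i} {j} e α) β =
      ≗ℂ-trans (a i j *ℂ wt (α ++ β)) (a i j *ℂ (wt α *ℂ wt β)) ((a i j *ℂ wt α) *ℂ wt β)
        (*ℂ-cong (a i j) (a i j) (wt (α ++ β)) (wt α *ℂ wt β) (≗ℂ-refl (a i j)) (wt-++ α β))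
        (≗ℂ-sym ((a i j *ℂ wt α) *ℂ wt β) (a i j *ℂ (wt α *ℂ wt β)) (*ℂ-assoc (a i j) (wt α) (wt β)))

    a-swap : ∀ i j → a j i ≗ℂ conj (a i j)
    a-swap i j with T? (edge i j) | T? (edge j i)
    ... | yes e | yes f = ⊥-elim (asym e f)
    ... | yes e | no _  = ≗ℂ-refl (conj (w i j e))
    ... | no _  | yes f = conj-involutive (w j i f)
    ... | no _  | no _  = (λ _ → refl) , λ _ → refl

    wt-reverse : ∀ {i j} (γ : Walk i j) → wt (reverse γ) ≗ℂ conj (wt γ)
    wt-reverse [] = (λ _ → refl) , λ _ → refl
    wt-reverse (_∷_ {i} {j} e γ) =
      ≗ℂ-trans (wt (reverse γ ++ (swap e ∷ []))) (wt (reverse γ) *ℂ (a j i *ℂ 1ℂ)) (conj (a i j *ℂ wt γ))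
        (wt-++ (reverse γ) (swap e ∷ []))
      (≗ℂ-trans (wt (reverse γ) *ℂ (a j i *ℂ 1ℂ)) (conj (wt γ) *ℂ conj (a i j)) (conj (a i j *ℂ wt γ))
        (*ℂ-cong (wt (reverse γ)) (conj (wt γ)) (a j i *ℂ 1ℂ) (conj (a i j)) (wt-reverse γ)
          (≗ℂ-trans (a j i *ℂ 1ℂ) (1ℂ *ℂ a j i) (conj (a i j)) (*ℂ-comm (a j i) 1ℂ)
            (≗ℂ-trans (1ℂ *ℂ a j i) (a j i) (conj (a i j)) (*ℂ-identityˡ (a j i)) (a-swap i j))))
      (≗ℂ-trans (conj (wt γ) *ℂ conj (a i j)) (conj (a i j) *ℂ conj (wt γ)) (conj (a i j *ℂ wt γ))
        (*ℂ-comm (conj (wt γ)) (conj (a i j)))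
        (≗ℂ-sym (conj (a i j *ℂ wt γ)) (conj (a i j) *ℂ conj (wt γ)) (conj-*ℂ (a i j) (wt γ)))))

    SameDirection-++ : ∀ {i j k} (α α′ : Walk i j) (β β′ : Walk j k) →
      SameDirection (wt α) (wt α′) → SameDirection (wt β) (wt β′) →
      SameDirection (wt (α ++ β)) (wt (α′ ++ β′))
    SameDirection-++ α α′ β β′ h k =
      SameDirection-resp-≗ℂ (wt α *ℂ wt β) (wt (α ++ β)) (wt α′ *ℂ wt β′) (wt (α′ ++ β′))
        (≗ℂ-sym (wt (α ++ β)) (wt α *ℂ wt β) (wt-++ α β))
        (≗ℂ-sym (wt (α′ ++ β′)) (wt α′ *ℂ wt β′) (wt-++ α′ β′))
        (SameDirection-* (wt α) (wt α′) (wt β) (wt β′) h k)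

    module _ (even-cycles-positive :
                ∀ {i} (C : Walk i i) → IsCycle C → IsEven C → PositiveReal (wt C)) where

      disjoint⇒SameDirection : ∀ {u j k v} (e : u ~ j) (f : u ~ k) (α : Walk j v) (β : Walk k v) →
        IsShortest (e ∷ α) → IsShortest (f ∷ β) → Disjoint (sources α) (sources β) →
        SameDirection (wt (e ∷ α)) (wt (f ∷ β))
      disjoint⇒SameDirection e f [] [] _ _ _ = SameDirection-refl (wt (e ∷ [])) (normSq-wt (e ∷ []))
      disjoint⇒SameDirection e f [] (_ ∷ _) _ shortβ _ with s≤s () ← shortβ (e ∷ [])
      disjoint⇒SameDirection e f (_ ∷ _) [] shortα _ _ with s≤s () ← shortα (f ∷ [])
      disjoint⇒SameDirection e f α@(_ ∷ α′) β@(_ ∷ _) shortα shortβ α#β =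
        PositiveReal-resp-≗ℂ (wt C) (wt γ₁ *ℂ conj (wt γ₂))
          (≗ℂ-trans (wt C) (wt γ₁ *ℂ wt (reverse γ₂)) (wt γ₁ *ℂ conj (wt γ₂))
            (wt-++ γ₁ (reverse γ₂))
            (*ℂ-cong (wt γ₁) (wt γ₁) (wt (reverse γ₂)) (conj (wt γ₂))
              (≗ℂ-refl (wt γ₁)) (wt-reverse γ₂)))
          (even-cycles-positive C
            ( subst (3 ≤_) (sym length-C) (s≤s (s≤s (ℕ.≤-trans (s≤s z≤n) (ℕ.m≤n+m _ (length α′)))))
            , disjoint⇒cycle-unique e f α β shortα shortβ α#β)
            (divides (length γ₁) (trans length-C (double (length γ₁)))))
        where
        γ₁ = e ∷ α
        γ₂ = f ∷ β
        C = γ₁ ++ reverse γ₂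
        length-C : length C ≡ length γ₁ + length γ₁
        length-C = trans (length-++ γ₁ (reverse γ₂))
          (cong (length γ₁ +_) (trans (length-reverse γ₂)
            (shortest-lengths γ₂ γ₁ shortβ shortα)))
        double : ∀ m → m + m ≡ m * 2
        double m = trans (cong (m +_) (sym (ℕ.+-identityʳ m))) (ℕ.*-comm 2 m)

      shortest⇒SameDirection : ∀ l {u v} (γ₁ γ₂ : Walk u v) → length γ₁ ≡ l →
        IsShortest γ₁ → IsShortest γ₂ → SameDirection (wt γ₁) (wt γ₂)
      shortest⇒SameDirection = <-rec _ step
        where
        Claim : ℕ → Set
        Claim l = ∀ {u v} (γ₁ γ₂ : Walk u v) → length γ₁ ≡ l →
          IsShortest γ₁ → IsShortest γ₂ → SameDirection (wt γ₁) (wt γ₂)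
        step : ∀ l → (∀ {m} → m < l → Claim m) → Claim l
        step l ih [] [] _ _ _ = SameDirection-refl 1ℂ normSq-1
        step l ih [] (f ∷ β) _ _ short₂ with () ← short₂ []
        step l ih (e ∷ α) [] _ short₁ _ with () ← short₁ []
        step l ih (e ∷ α) (f ∷ β) refl short₁ short₂
          with any? (λ x → any? (x ≟ᶠ_) (sources β)) (sources α)
        ... | no ¬common = disjoint⇒SameDirection e f α β short₁ short₂
          (λ (x∈α , x∈β) → ¬common (Any.map (λ { refl → x∈β }) x∈α))
        ... | yes common with find common
        ...   | x , x∈α , x∈β with split α x∈α | split β x∈β
        ...     | α₁ , α₂ , refl , 1≤α₂ | β₁ , β₂ , refl , _ =
          SameDirection-++ (e ∷ α₁) (f ∷ β₁) α₂ β₂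
            (ih (s≤s (subst (length α₁ <_) (sym (length-++ α₁ α₂)) (ℕ.m<m+n (length α₁) 1≤α₂)))
              (e ∷ α₁) (f ∷ β₁) refl
              (shortest-prefix (e ∷ α₁) α₂ short₁) (shortest-prefix (f ∷ β₁) β₂ short₂))
            (ih (s≤s (subst (length α₂ ≤_) (sym (length-++ α₁ α₂)) (ℕ.m≤n+m (length α₂) (length α₁))))
              α₂ β₂ refl
              (shortest-suffix (e ∷ α₁) α₂ short₁) (shortest-suffix (f ∷ β₁) β₂ short₂))

lemma2p3 :
  (n : ℕ) → 2 ≤ n →
  (G : OrientedGraph n) (W : Weighting G) →
  let open OrientedGraph G
      open Weighting W
  in
  WeaklyConnected →
  1 ≤ edgeCount →
  (∀ i j (e : Edge i j) → ¬ NegativeReal (w i j e)) →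
  (∀ {i} (C : Walk i i) → IsCycle C → IsEven C → PositiveReal (wt C)) →
  (u v : Fin n) (γ₁ γ₂ : Walk u v) → IsShortest γ₁ → IsShortest γ₂ →
  wt γ₁ / ∣ wt γ₁ ∣ℂ [ ∣wt∣#0 γ₁ ] ≈ℂ wt γ₂ / ∣ wt γ₂ ∣ℂ [ ∣wt∣#0 γ₂ ]
lemma2p3 n _ G W _ _ _ even-cycles-positive u v γ₁ γ₂ short₁ short₂ =
  SameDirection⇒≈ (wt γ₁) (wt γ₂) (normSq-wt γ₁) (normSq-wt γ₂) (∣wt∣#0 γ₁) (∣wt∣#0 γ₂)
    (shortest⇒SameDirection G W even-cycles-positive _ γ₁ γ₂ refl short₁ short₂)
  where open Weighting W
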